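{- $$\sum_{\pi\in\mathcal{E}_N^{O}}q^{|\pi|}=(-q;q)_\infty^2+\frac{1}{(q;q)_\infty}-(-q;q)_\infty .$$
   Context: An overpartition is a finite non-increasing sequence of positive integers (its parts) in which the first occurrence of each number may be overlined (so for each size $t$ at most one part of size $t$ is overlined); the size of a part $t$ or $\overline{t}$ is $t$, and the weight $|\pi|$ is the sum of the sizes of the parts. The empty overpartition has weight $0$. $\mathcal{E}_N^{O}$ is the set of overpartitions (including the empty one) such that the sizes of overlined parts (if any exist) are greater than or equal to the sizes of all non-overlined parts. Here $|q|<1$ (or $q$ is a formal variable), $(a;q)_\infty=\prod_{i=0}^{\infty}(1-aq^i)$. -}

module Defs where

open import Level using (0ℓ)
open import Data.Bool using (Bool; true; false)
open import Data.Nat as ℕ using (ℕ; zero; suc; z≤n; s≤s; _<_; _≥_; _∸_)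
import Data.Nat.Properties as ℕ
import Data.Nat.ListAction as ℕ using (sum)
open import Data.Integer as ℤ using (ℤ; 0ℤ; 1ℤ)
import Data.Integer.Properties as ℤ
open import Data.Fin using (toℕ)
open import Data.List using (List; foldr; map)
open import Data.List.Membership.Propositional using (_∈_)
open import Data.List.Relation.Unary.All using (All)
open import Data.List.Relation.Unary.AllPairs using (AllPairs)
open import Data.List.Relation.Unary.Linked using (Linked)
open import Data.List.Relation.Unary.Unique.Propositional using (Unique)
open import Relation.Unary using (Pred)
open import Relation.Binary.PropositionalEquality
open import Algebra.Properties.Semiring.Sum ℤ.+-*-semiring using (sum⁺-syntax)

------------------------------------------------------------------------
-- Formal power series ℤ⟦q⟧, represented by their coefficients

PowerSeries : Set
PowerSeries = ℕ → ℤ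

infix  8 -_
infixl 6 _+_ _-_
infixl 7 _*_ _÷_
infixr 8 _^_

0ₛ 1ₛ q : PowerSeries
0ₛ _ = 0ℤ

1ₛ zero    = 1ℤ
1ₛ (suc _) = 0ℤ

q zero    = 0ℤ
q (suc n) = 1ₛ n

-_ : PowerSeries → PowerSeries
(- f) n = ℤ.- f n

_+_ _-_ _*_ : PowerSeries → PowerSeries → PowerSeries
(f + g) n = f n ℤ.+ g n
(f - g) n = f n ℤ.- g n
(f * g) n = ∑[ i ≤ n ] (f (toℕ i) ℤ.* g (n ∸ toℕ i))

_^_ : PowerSeries → ℕ → PowerSeries
f ^ zero  = 1ₛ
f ^ suc n = f * f ^ n

-- Long division by a series f with constant term 1:
--   g / f = g₀ + q · ((g - g₀ f) / q) / f.
-- See ÷-correct; the value is meaningless for other f.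
_÷_ : PowerSeries → PowerSeries → PowerSeries
(g ÷ f) zero    = g 0
(g ÷ f) (suc n) = ((λ k → g (suc k) ℤ.- g 0 ℤ.* f (suc k)) ÷ f) n

-- (a; q)ₙ = ∏_{0 ≤ i < n} (1 - a qⁱ)
qPoch : PowerSeries → ℕ → PowerSeries
qPoch a zero    = 1ₛ
qPoch a (suc n) = qPoch a n * (1ₛ - a * q ^ n)

-- (a; q)_∞ is the coefficientwise limit of (a; q)ₘ as m → ∞.  The factors
-- with i > n are 1 modulo qⁿ⁺¹, so the coefficient of qⁿ no longer changes
-- once m > n; see qPoch-limit.
qPoch∞ : PowerSeries → PowerSeries
qPoch∞ a n = qPoch a (suc n) n

-- HasSum P f s: the family (f x)_{x ∈ P} is summable with sum s, i.e. for each
-- n only finitely many x ∈ P have a nonzero coefficient at qⁿ in f x, and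
-- these coefficients add up to that of s.  The list support n may also contain
-- elements of P whose coefficient is zero.
record HasSum {A : Set} (P : Pred A 0ℓ) (f : A → PowerSeries) (s : PowerSeries) : Set where
  field
    support  : ℕ → List A
    unique   : ∀ n → Unique (support n)
    sound    : ∀ n → All P (support n)
    complete : ∀ n x → P x → f x n ≢ 0ℤ → x ∈ support n
    total    : ∀ n → foldr ℤ._+_ 0ℤ (map (λ x → f x n) (support n)) ≡ s n

------------------------------------------------------------------------
-- Overpartitions

record Part : Set where
  constructor part
  field
    size      : ℕ
    overlined : Bool

open Part public

weight : List Part → ℕ
weight π = ℕ.sum (map size π)

record IsOverpartition (π : List Part) : Set where
  field
    positive       : All (λ x → size x ℕ.> 0) π
    nonincreasing  : Linked (λ x y → size x ≥ size y) π
    firstOverlined : AllPairs (λ x y → size x ≡ size y → overlined y ≡ false) π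

record ℰᴼ (π : List Part) : Set where
  field
    isOverpartition : IsOverpartition π
    overlined≥plain : ∀ {x y} → x ∈ π → y ∈ π →
                      overlined x ≡ true → overlined y ≡ false → size x ≥ size y

------------------------------------------------------------------------
-- Justification of _÷_ and qPoch∞

*-cong-≤ : ∀ {f f′ g g′} n → (∀ {k} → k ℕ.≤ n → f k ≡ f′ k) →
           (∀ {k} → k ℕ.≤ n → g k ≡ g′ k) → (f * g) n ≡ (f′ * g′) n
*-cong-≤ zero    p r = cong₂ (λ x y → x ℤ.* y ℤ.+ 0ℤ) (p z≤n) (r z≤n)
*-cong-≤ (suc n) p r = cong₂ ℤ._+_ (cong₂ ℤ._*_ (p z≤n) (r ℕ.≤-refl))
  (*-cong-≤ n (λ k≤n → p (s≤s k≤n)) (λ k≤n → r (ℕ.m≤n⇒m≤1+n k≤n)))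

*-zeroˡ : ∀ f n → (0ₛ * f) n ≡ 0ℤ
*-zeroˡ f zero    = refl
*-zeroˡ f (suc n) = trans (ℤ.+-identityˡ _) (*-zeroˡ f n)

*-zeroʳ : ∀ f n → (f * 0ₛ) n ≡ 0ℤ
*-zeroʳ f zero    = trans (ℤ.+-identityʳ _) (ℤ.*-zeroʳ (f 0))
*-zeroʳ f (suc n) = cong₂ ℤ._+_ (ℤ.*-zeroʳ (f 0)) (*-zeroʳ (λ k → f (suc k)) n)

*-identityˡ : ∀ f n → (1ₛ * f) n ≡ f n
*-identityˡ f zero    = trans (ℤ.+-identityʳ _) (ℤ.*-identityˡ (f 0))
*-identityˡ f (suc n) = trans (cong₂ ℤ._+_ (ℤ.*-identityˡ (f (suc n))) (*-zeroˡ f n))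
                              (ℤ.+-identityʳ _)

*-identityʳ : ∀ f n → (f * 1ₛ) n ≡ f n
*-identityʳ f zero    = trans (ℤ.+-identityʳ _) (ℤ.*-identityʳ (f 0))
*-identityʳ f (suc n) = trans (cong₂ ℤ._+_ (ℤ.*-zeroʳ (f 0)) (*-identityʳ (λ k → f (suc k)) n))
                              (ℤ.+-identityˡ _)

q^-vanishes : ∀ {n m} → n < m → (q ^ m) n ≡ 0ℤ
q^-vanishes {zero}  {suc m} _         = refl
q^-vanishes {suc n} {suc m} (s≤s n<m) = trans (ℤ.+-identityˡ _)
  (trans (*-identityˡ (q ^ m) n) (q^-vanishes n<m))

qPoch-step : ∀ a {n m} → n < m → qPoch a (suc m) n ≡ qPoch a m n
qPoch-step a {n} {m} n<m = trans (*-cong-≤ {f = qPoch a m} n (λ _ → refl) factor) (*-identityʳ (qPoch a m) n)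
  where
  factor : ∀ {k} → k ℕ.≤ n → (1ₛ - a * q ^ m) k ≡ 1ₛ k
  factor {k} k≤n = trans (cong (λ z → 1ₛ k ℤ.- z) (trans
      (*-cong-≤ {f = a} k (λ _ → refl) (λ j≤k → q^-vanishes (ℕ.≤-<-trans (ℕ.≤-trans j≤k k≤n) n<m)))
      (*-zeroʳ a k)))
    (ℤ.+-identityʳ (1ₛ k))

qPoch-limit : ∀ a {n m} → n < m → qPoch a m n ≡ qPoch∞ a n
qPoch-limit a {n} n<m = go (ℕ.≤⇒≤′ n<m)
  where
  go : ∀ {m} → suc n ℕ.≤′ m → qPoch a m n ≡ qPoch∞ a n
  go ℕ.≤′-refl       = refl
  go (ℕ.≤′-step n<m) = trans (qPoch-step a (ℕ.≤′⇒≤ n<m)) (go n<m)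

*-suc : ∀ f g n → (f * g) (suc n) ≡ f (suc n) ℤ.* g 0 ℤ.+ (f * (λ k → g (suc k))) n
*-suc f g zero = begin
  f 0 ℤ.* g 1 ℤ.+ (f 1 ℤ.* g 0 ℤ.+ 0ℤ)   ≡⟨ cong (ℤ._+_ (f 0 ℤ.* g 1)) (ℤ.+-identityʳ _) ⟩
  f 0 ℤ.* g 1 ℤ.+ f 1 ℤ.* g 0            ≡⟨ ℤ.+-comm (f 0 ℤ.* g 1) _ ⟩
  f 1 ℤ.* g 0 ℤ.+ f 0 ℤ.* g 1            ≡⟨ cong (ℤ._+_ (f 1 ℤ.* g 0)) (ℤ.+-identityʳ _) ⟨
  f 1 ℤ.* g 0 ℤ.+ (f 0 ℤ.* g 1 ℤ.+ 0ℤ)   ∎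
  where open ≡-Reasoning
*-suc f g (suc n) = begin
  x ℤ.+ ((λ k → f (suc k)) * g) (suc n)   ≡⟨ cong (ℤ._+_ x) (*-suc (λ k → f (suc k)) g n) ⟩
  x ℤ.+ (y ℤ.+ z)                         ≡⟨ ℤ.+-assoc x y z ⟨
  x ℤ.+ y ℤ.+ z                           ≡⟨ cong (ℤ._+ z) (ℤ.+-comm x y) ⟩
  y ℤ.+ x ℤ.+ z                           ≡⟨ ℤ.+-assoc y x z ⟩
  y ℤ.+ (x ℤ.+ z)                         ∎
  where
  open ≡-Reasoning
  x y z : ℤ
  x = f 0 ℤ.* g (suc (suc n))
  y = f (suc (suc n)) ℤ.* g 0
  z = ((λ k → f (suc k)) * (λ k → g (suc k))) n

÷-correct : ∀ f g → f 0 ≡ 1ℤ → ∀ n → (f * (g ÷ f)) n ≡ g n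
÷-correct f g f₀≡1 zero = trans (ℤ.+-identityʳ _)
  (trans (cong (ℤ._* g 0) f₀≡1) (ℤ.*-identityˡ (g 0)))
÷-correct f g f₀≡1 (suc n) = begin
  (f * (g ÷ f)) (suc n)                ≡⟨ *-suc f (g ÷ f) n ⟩
  f (suc n) ℤ.* g 0 ℤ.+ (f * (_ ÷ f)) n
    ≡⟨ cong₂ ℤ._+_ (ℤ.*-comm (f (suc n)) (g 0)) (÷-correct f _ f₀≡1 n) ⟩
  x ℤ.+ (g (suc n) ℤ.- x)              ≡⟨ cong (ℤ._+_ x) (ℤ.+-comm (g (suc n)) (ℤ.- x)) ⟩
  x ℤ.+ (ℤ.- x ℤ.+ g (suc n))          ≡⟨ ℤ.+-assoc x (ℤ.- x) (g (suc n)) ⟨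
  x ℤ.- x ℤ.+ g (suc n)                ≡⟨ cong (ℤ._+ g (suc n)) (ℤ.+-inverseʳ x) ⟩
  0ℤ ℤ.+ g (suc n)                     ≡⟨ ℤ.+-identityˡ (g (suc n)) ⟩
  g (suc n)                            ∎
  where
  open ≡-Reasoning
  x : ℤ
  x = g 0 ℤ.* f (suc n)

1÷qPoch∞-correct : ∀ n → (qPoch∞ q * (1ₛ ÷ qPoch∞ q)) n ≡ 1ₛ n
1÷qPoch∞-correct = ÷-correct (qPoch∞ q) 1ₛ refl

{-# OPTIONS --safe #-}
module Submission where

-- Classify the nonempty elements of ℰᴼ by their largest part.  With D m and E m
-- the generating functions of the partitions and of the elements of ℰᴼ with all
-- parts ≤ m, this gives
--   D (m+1) = D m + qᵐ⁺¹ D (m+1),   E (m+1) = (1 + qᵐ⁺¹) (E m + qᵐ⁺¹ D (m+1)),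
-- hence E m - D m + (-q; q)ₘ = S q m, where
--   S z m = ∑_{s ≤ m} zˢ (-qˢ⁺¹; q)ₘ₋ₛ / (q; q)ₛ.
-- As m → ∞, (1 - z) S z = S (z q²), so (q; q²)_∞ · S q = S 0 = (-q; q)_∞, and
-- Euler's identity (q; q²)_∞ (-q; q)_∞ = 1 yields S q = (-q; q)_∞².
-- The coefficient of qⁿ is computed modulo qⁿ⁺¹, where q is nilpotent and all
-- the infinite products become finite.

open import Level using (0ℓ)
open import Algebra.Bundles using (CommutativeRing)
open import Data.Bool using (true; false)
open import Data.Nat as ℕ using (ℕ; zero; suc; z≤n; s≤s)
import Data.Nat.Properties as ℕ
open import Data.Nat.Induction using (<-rec)
open import Data.Integer as ℤ using (ℤ; 0ℤ; 1ℤ)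
import Data.Integer.Properties as ℤ
open import Data.Integer.Solver using (module +-*-Solver)
open import Data.List using (List; []; _∷_; _++_; map; length; foldr)
open import Data.List.Properties using (length-++; length-map; ∷-injectiveʳ)
open import Data.List.Membership.Propositional using (_∈_)
open import Data.List.Membership.Propositional.Properties using (∈-++⁺ˡ; ∈-++⁺ʳ; ∈-map⁺)
open import Data.List.Relation.Unary.Any using (here; there)
open import Data.List.Relation.Unary.All as All using (All; []; _∷_)
import Data.List.Relation.Unary.All.Properties as All
open import Data.List.Relation.Unary.AllPairs as AllPairs using ([]; _∷_)
open import Data.List.Relation.Unary.Linked as Linked using (Linked; [-]; []; _∷_)
open import Data.List.Relation.Unary.Linked.Properties using (Linked⇒AllPairs)
open import Data.List.Relation.Unary.Unique.Propositional using (Unique)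
import Data.List.Relation.Unary.Unique.Propositional.Properties as Unique
open import Data.Product using (_×_; _,_; proj₁; proj₂)
open import Data.Sum using (inj₁; inj₂; [_,_]′)
open import Function using (flip)
open import Relation.Nullary using (¬_; yes; no; contradiction)
open import Relation.Unary using (Pred; _∪_; _⊆_)
import Relation.Binary.PropositionalEquality as ≡

-- The series identity in a ring with a nilpotent element

module Nilpotent {c ℓ} (R : CommutativeRing c ℓ) (x : CommutativeRing.Carrier R) (M : ℕ) where
  open CommutativeRing R
  open import Algebra.Properties.Semiring.Exp semiring public
  open import Algebra.Properties.CommutativeSemiring.Exp commutativeSemiring using (^-distrib-*)
  open import Algebra.Properties.Ring ring using ([y-z]x≈yx-zx; -0#≈0#; -‿distribˡ-*; -‿involutive)
  open import Algebra.Properties.Group +-group using (//-rightDividesˡ; //-rightDividesʳ; ∙-cancelʳ)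
  open import Algebra.Solver.Ring.NaturalCoefficients.Default commutativeSemiring
  open import Relation.Binary.Reasoning.Setoid setoid

  poch : Carrier → ℕ → Carrier
  poch a zero    = 1#
  poch a (suc m) = poch a m * (1# - a * x ^ m)

  -- O m is (x; x²)ₘ.
  A P O : ℕ → Carrier
  A = poch (- x)
  P = poch x
  O zero    = 1#
  O (suc m) = O m * (1# - x ^ suc (m ℕ.+ m))

  A-suc : ∀ m → A (suc m) ≈ A m * (1# + x ^ suc m)
  A-suc m = *-congˡ (+-congˡ (trans (-‿cong (sym (-‿distribˡ-* x (x ^ m)))) (-‿involutive (x ^ suc m))))

  -- The solver covers commutative semirings only, so `1# - u` enters it as an atom, and `u * u` is
  -- first added to both sides.
  1-u*1+u : ∀ u → (1# - u) * (1# + u) ≈ 1# - u * u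
  1-u*1+u u = ∙-cancelʳ (u * u) _ _ (begin
    (1# - u) * (1# + u) + u * u             ≈⟨ solve 2 (λ t u → t :* (con 1 :+ u) :+ u :* u := t :+ (t :+ u) :* u) refl (1# - u) u ⟩
    (1# - u) + (1# - u + u) * u             ≈⟨ +-congˡ (trans (*-congʳ (//-rightDividesˡ u 1#)) (*-identityˡ u)) ⟩
    1# - u + u                              ≈⟨ //-rightDividesˡ u 1# ⟩
    1#                                      ≈⟨ //-rightDividesˡ (u * u) 1# ⟨
    1# - u * u + u * u                      ∎)

  -- The factors of `P (k + k)` with odd exponent form `O k`. Those with even exponent split as
  -- `1 - u² = (1 - u)(1 + u)` and form `P k * A k`.
  P-double : ∀ k → P (k ℕ.+ k) ≈ O k * (P k * A k)
  P-double zero    = sym (trans (*-identityˡ _) (*-identityˡ _))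
  P-double (suc k) rewrite ℕ.+-suc k k = begin
    P (k ℕ.+ k) * a * (1# - x ^ suc (suc (k ℕ.+ k)))
      ≈⟨ *-cong (*-congʳ (P-double k)) (+-congˡ (-‿cong (trans (^-congʳ x (≡.sym (ℕ.+-suc (suc k) k))) (^-homo-* x (suc k) (suc k))))) ⟩
    O k * (P k * A k) * a * (1# - u * u)
      ≈⟨ *-congˡ (1-u*1+u u) ⟨
    O k * (P k * A k) * a * ((1# - u) * (1# + u))
      ≈⟨ solve 6 (λ o p a b s t → o :* (p :* a) :* b :* (s :* t) := o :* b :* (p :* s :* (a :* t)))
           refl (O k) (P k) (A k) a (1# - u) (1# + u) ⟩
    O k * a * (P k * (1# - u) * (A k * (1# + u)))
      ≈⟨ *-congˡ (*-congˡ (A-suc k)) ⟨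
    O k * a * (P (suc k) * A (suc k)) ∎
    where
    a u : Carrier
    a = 1# - x ^ suc (k ℕ.+ k)
    u = x ^ suc k

  module _
    (D E : ℕ → Carrier)
    (D₀ : D 0 ≈ 1#) (D-suc : ∀ m → D (suc m) ≈ D m + x ^ suc m * D (suc m))
    (E₀ : E 0 ≈ 1#) (E-suc : ∀ m → E (suc m) ≈ E m + x ^ suc m * D (suc m) + x ^ suc m * (E m + x ^ suc m * D (suc m)))
    where

    -- The recurrence for `D` says `(1 - x ^ suc m) * D (suc m) = D m`, so the new factor of `P`
    -- cancels.
    D*P≈1 : ∀ m → D m * P m ≈ 1#
    D*P≈1 zero    = trans (*-identityʳ _) D₀
    D*P≈1 (suc m) = begin
      d * (P m * (1# - u))    ≈⟨ solve 3 (λ d p t → d :* (p :* t) := t :* d :* p) refl d (P m) (1# - u) ⟩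
      (1# - u) * d * P m      ≈⟨ *-congʳ ([y-z]x≈yx-zx d 1# u) ⟩
      (1# * d - u * d) * P m  ≈⟨ *-congʳ (+-congʳ (trans (*-identityˡ d) (D-suc m))) ⟩
      (D m + u * d - u * d) * P m  ≈⟨ *-congʳ (//-rightDividesʳ (u * d) (D m)) ⟩
      D m * P m               ≈⟨ D*P≈1 m ⟩
      1#                      ∎
      where
      d u : Carrier
      d = D (suc m)
      u = x ^ suc m

    -- Raising the bound of the sum multiplies every old summand by `1# + x ^ suc m` and adds the
    -- summand `s = suc m`.
    S : Carrier → ℕ → Carrier
    S z zero    = 1#
    S z (suc m) = (1# + x ^ suc m) * S z m + z ^ suc m * D (suc m)

    -- Both sides satisfy `T (suc m) = (1 + u) * (T m + u * D (suc m))` with `u = x ^ suc m`.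
    E+A≈S+D : ∀ m → E m + A m ≈ S x m + D m
    E+A≈S+D zero    = trans (+-congʳ E₀) (+-congˡ (sym D₀))
    E+A≈S+D (suc m) = begin
      E (suc m) + A (suc m)                      ≈⟨ +-cong (E-suc m) (A-suc m) ⟩
      E m + u * d + u * (E m + u * d) + A m * (1# + u)  ≈⟨ solve 4 (λ u e d a →
        e :+ u :* d :+ u :* (e :+ u :* d) :+ a :* (con 1 :+ u) := (con 1 :+ u) :* (e :+ a) :+ (con 1 :+ u) :* (u :* d)) refl u (E m) d (A m) ⟩
      (1# + u) * (E m + A m) + (1# + u) * (u * d) ≈⟨ +-congʳ (*-congˡ (E+A≈S+D m)) ⟩
      (1# + u) * (S x m + D m) + (1# + u) * (u * d) ≈⟨ solve 4 (λ u s d d′ →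
        (con 1 :+ u) :* (s :+ d) :+ (con 1 :+ u) :* (u :* d′) := (con 1 :+ u) :* s :+ u :* (d :+ u :* d′) :+ (d :+ u :* d′)) refl u (S x m) (D m) d ⟩
      (1# + u) * S x m + u * (D m + u * d) + (D m + u * d) ≈⟨ +-cong (+-congˡ (*-congˡ (D-suc m))) (D-suc m) ⟨
      (1# + u) * S x m + u * d + d ∎
      where
      d u : Carrier
      d = D (suc m)
      u = x ^ suc m

    -- The finite form of `(1 - z) S z = S (z x²)`, with boundary term `z ^ suc m * D m`. The
    -- inductive step rests on `(1 - u²) D (suc m) = (1 + u) D m`, which is the recurrence for `D`
    -- used twice.
    S-functional : ∀ z m → S z m + z ^ suc m * D m ≈ S (z * (x * x)) m + z * S z m
    S-functional z zero    = +-congˡ (trans (*-congˡ D₀) (*-congʳ (*-identityʳ z)))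
    S-functional z (suc m) = begin
      (1# + u) * s + w * d + z * w * d
        ≈⟨ +-congʳ (+-congˡ (*-congˡ D-suc²)) ⟩
      (1# + u) * s + w * ((1# + u) * D m + u * u * d) + z * w * d
        ≈⟨ solve 6 (λ u s w c d z →
             (con 1 :+ u) :* s :+ w :* ((con 1 :+ u) :* c :+ u :* u :* d) :+ z :* w :* d :=
             (con 1 :+ u) :* (s :+ w :* c) :+ w :* (u :* u) :* d :+ z :* w :* d) refl u s w (D m) d z ⟩
      (1# + u) * (s + w * D m) + w * (u * u) * d + z * w * d
        ≈⟨ +-congʳ (+-cong (*-congˡ (S-functional z m)) (*-congʳ (sym w′))) ⟩
      (1# + u) * (S z′ m + z * s) + z′ ^ suc m * d + z * w * d
        ≈⟨ solve 7 (λ u s t w v d z →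
             (con 1 :+ u) :* (t :+ z :* s) :+ v :* d :+ z :* w :* d :=
             (con 1 :+ u) :* t :+ v :* d :+ z :* ((con 1 :+ u) :* s :+ w :* d)) refl u s (S z′ m) w (z′ ^ suc m) d z ⟩
      (1# + u) * S z′ m + z′ ^ suc m * d + z * ((1# + u) * s + w * d) ∎
      where
      d s u w z′ : Carrier
      d = D (suc m)
      s = S z m
      u = x ^ suc m
      w = z ^ suc m
      z′ = z * (x * x)
      D-suc² : d ≈ (1# + u) * D m + u * u * d
      D-suc² = trans (D-suc m) (trans (+-congˡ (*-congˡ (D-suc m)))
        (solve 3 (λ c d u → c :+ u :* (c :+ u :* d) := (con 1 :+ u) :* c :+ u :* u :* d) refl (D m) d u))
      w′ : z′ ^ suc m ≈ w * (u * u)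
      w′ = trans (^-distrib-* z (x * x) (suc m)) (*-congˡ (^-distrib-* x x (suc m)))

    S-cong : ∀ {y z} → y ≈ z → ∀ m → S y m ≈ S z m
    S-cong y≈z zero    = refl
    S-cong y≈z (suc m) = +-cong (*-congˡ (S-cong y≈z m)) (*-congʳ (^-congˡ (suc m) y≈z))

    S-zero : ∀ m → S 0# m ≈ A m
    S-zero zero    = refl
    S-zero (suc m) = trans (+-cong (*-congˡ (S-zero m)) (trans (*-congʳ (zeroˡ _)) (zeroˡ _)))
                           (trans (+-identityʳ _) (trans (*-comm _ _) (sym (A-suc m))))

    module _ (x^M≈0 : x ^ M ≈ 0#) where

      x^[M+n]≈0 : ∀ n → x ^ (M ℕ.+ n) ≈ 0#
      x^[M+n]≈0 n = trans (^-homo-* x M n) (trans (*-congʳ x^M≈0) (zeroˡ _))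

      -- Every factor added beyond index `M` is `1 - 0`. The case `n = M` identifies `P (M + M)`
      -- with `P M`, so that `P-double` yields Euler's identity.
      P-stable : ∀ n → P (M ℕ.+ n) ≈ P M
      P-stable zero    rewrite ℕ.+-identityʳ M = refl
      P-stable (suc n) rewrite ℕ.+-suc M n = trans (*-cong (P-stable n)
        (trans (+-congˡ (trans (-‿cong (trans (*-congˡ (x^[M+n]≈0 n)) (zeroʳ x))) -0#≈0#)) (+-identityʳ 1#)))
        (*-identityʳ (P M))

      -- Euler: distinct parts and odd parts are equinumerous.
      O*A≈1 : O M * A M ≈ 1#
      O*A≈1 = begin
        O M * A M                    ≈⟨ *-identityˡ _ ⟨
        1# * (O M * A M)             ≈⟨ *-congʳ (D*P≈1 M) ⟨
        D M * P M * (O M * A M)      ≈⟨ solve 4 (λ d p o a → d :* p :* (o :* a) := d :* (o :* (p :* a))) refl (D M) (P M) (O M) (A M) ⟩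
        D M * (O M * (P M * A M))    ≈⟨ *-congˡ (trans (sym (P-double M)) (P-stable M)) ⟩
        D M * P M                    ≈⟨ D*P≈1 M ⟩
        1#                           ∎

      -- Kills the boundary term of `S-functional` at `m = M` when `z` is a positive power of `x`.
      odd-power-vanishes : ∀ k → (x ^ suc k) ^ suc M ≈ 0#
      odd-power-vanishes k = begin
        (x ^ suc k) ^ suc M            ≈⟨ *-congˡ (^-distrib-* x (x ^ k) M) ⟩
        x ^ suc k * (x ^ M * (x ^ k) ^ M)  ≈⟨ *-congˡ (trans (*-congʳ x^M≈0) (zeroˡ _)) ⟩
        x ^ suc k * 0#                 ≈⟨ zeroʳ _ ⟩
        0#                             ∎

      S-step : ∀ k → (1# - x ^ suc k) * S (x ^ suc k) M ≈ S (x ^ suc k * (x * x)) M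
      S-step k = begin
        (1# - z) * S z M                       ≈⟨ [y-z]x≈yx-zx _ _ _ ⟩
        1# * S z M - z * S z M                 ≈⟨ +-congʳ (trans (*-identityˡ _) (sym (+-identityʳ _))) ⟩
        S z M + 0# - z * S z M                 ≈⟨ +-congʳ (+-congˡ (trans (*-congʳ (odd-power-vanishes k)) (zeroˡ _))) ⟨
        S z M + z ^ suc M * D M - z * S z M    ≈⟨ +-congʳ (S-functional z M) ⟩
        S (z * (x * x)) M + z * S z M - z * S z M  ≈⟨ //-rightDividesʳ _ _ ⟩
        S (z * (x * x)) M                      ∎
        where
        z : Carrier
        z = x ^ suc k

      -- Iterating `S-step` from `z = x` moves the argument through `x`, `x³`, `x⁵`, and so on; the
      -- factors picked up on the way are those of `O`.
      O*S : ∀ k → O k * S x M ≈ S (x ^ suc (k ℕ.+ k)) M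
      O*S zero    = trans (*-identityˡ _) (S-cong (sym (*-identityʳ x)) M)
      O*S (suc k) = begin
        O k * t * S x M                    ≈⟨ solve 3 (λ o t s → o :* t :* s := t :* (o :* s)) refl (O k) t (S x M) ⟩
        t * (O k * S x M)                  ≈⟨ *-congˡ (O*S k) ⟩
        t * S (x ^ suc (k ℕ.+ k)) M        ≈⟨ S-step (k ℕ.+ k) ⟩
        S (x ^ suc (k ℕ.+ k) * (x * x)) M  ≈⟨ S-cong shift M ⟩
        S (x ^ suc (suc k ℕ.+ suc k)) M    ∎
        where
        t : Carrier
        t = 1# - x ^ suc (k ℕ.+ k)
        shift : x ^ suc (k ℕ.+ k) * (x * x) ≈ x ^ suc (suc k ℕ.+ suc k)
        shift rewrite ℕ.+-suc k k = solve 2 (λ x y → x :* y :* (x :* x) := x :* (x :* (x :* y))) refl x (x ^ (k ℕ.+ k))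

      S≈A² : S x M ≈ A M * A M
      S≈A² = begin
        S x M                    ≈⟨ *-identityʳ _ ⟨
        S x M * 1#               ≈⟨ *-congˡ O*A≈1 ⟨
        S x M * (O M * A M)      ≈⟨ solve 3 (λ s o a → s :* (o :* a) := o :* s :* a) refl (S x M) (O M) (A M) ⟩
        -- After `M` iterations the argument is `x ^ suc (M + M)`, which is zero.
        O M * S x M * A M        ≈⟨ *-congʳ (trans (O*S M) (S-cong (trans (*-congˡ (x^[M+n]≈0 M)) (zeroʳ x)) M)) ⟩
        S 0# M * A M             ≈⟨ *-congʳ (S-zero M) ⟩
        A M * A M                ∎

      -- `D∞` equals `D M` because both invert the same element. The product `A∞ * (A∞ * 1#)` is how
      -- `_^_` unfolds at exponent 2.
      E≈A²+D-A : ∀ {A∞ P∞ D∞} → A M ≈ A∞ → P M ≈ P∞ → P∞ * D∞ ≈ 1# →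
                 E M ≈ A∞ * (A∞ * 1#) + D∞ - A∞
      E≈A²+D-A {A∞} {P∞} {D∞} A≈A∞ P≈P∞ P∞*D∞≈1 = begin
        E M                        ≈⟨ //-rightDividesʳ (A M) (E M) ⟨
        E M + A M - A M            ≈⟨ +-congʳ (E+A≈S+D M) ⟩
        S x M + D M - A M          ≈⟨ +-cong (+-cong S≈A∞² D≈D∞) (-‿cong A≈A∞) ⟩
        A∞ * (A∞ * 1#) + D∞ - A∞   ∎
        where
        S≈A∞² : S x M ≈ A∞ * (A∞ * 1#)
        S≈A∞² = trans S≈A² (*-cong A≈A∞ (trans A≈A∞ (sym (*-identityʳ A∞))))
        D≈D∞ : D M ≈ D∞
        D≈D∞ = begin
          D M                ≈⟨ *-identityʳ (D M) ⟨
          D M * 1#           ≈⟨ *-congˡ P∞*D∞≈1 ⟨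
          D M * (P∞ * D∞)    ≈⟨ *-assoc (D M) P∞ D∞ ⟨
          D M * P∞ * D∞      ≈⟨ *-congʳ (*-congˡ P≈P∞) ⟨
          D M * P M * D∞     ≈⟨ *-congʳ (D*P≈1 M) ⟩
          1# * D∞            ≈⟨ *-identityˡ D∞ ⟩
          D∞                 ∎

-- Power series modulo qⁿ⁺¹

open import Defs
open import Relation.Binary.PropositionalEquality

shift : PowerSeries → PowerSeries
shift f k = f (suc k)

-- A convolution at `suc n` unfolds to its first term plus a convolution at `n` whose left factor is
-- shifted; hence the ring laws go by induction on the index, with the series varying.
*-distribʳ-+ : ∀ f g h n → ((g + h) * f) n ≡ (g * f + h * f) n
*-distribʳ-+ f g h zero    = +-*-Solver.solve 3
  (λ f g h → (g :+ h) :* f :+ con 0ℤ := g :* f :+ con 0ℤ :+ (h :* f :+ con 0ℤ)) refl (f 0) (g 0) (h 0)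
  where open +-*-Solver
*-distribʳ-+ f g h (suc n) = trans
  (cong (ℤ._+_ ((g 0 ℤ.+ h 0) ℤ.* f (suc n))) (*-distribʳ-+ f (shift g) (shift h) n))
  (+-*-Solver.solve 5 (λ f g h s t → (g :+ h) :* f :+ (s :+ t) := g :* f :+ s :+ (h :* f :+ t))
    refl (f (suc n)) (g 0) (h 0) ((shift g * f) n) ((shift h * f) n))
  where open +-*-Solver

*-scaleˡ : ∀ c f g n → ((λ k → c ℤ.* f k) * g) n ≡ c ℤ.* (f * g) n
*-scaleˡ c f g zero    = +-*-Solver.solve 3 (λ c f g → c :* f :* g :+ con 0ℤ := c :* (f :* g :+ con 0ℤ)) refl c (f 0) (g 0)
  where open +-*-Solver
*-scaleˡ c f g (suc n) = trans (cong (ℤ._+_ (c ℤ.* f 0 ℤ.* g (suc n))) (*-scaleˡ c (shift f) g n))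
  (+-*-Solver.solve 4 (λ c f g s → c :* f :* g :+ c :* s := c :* (f :* g :+ s)) refl c (f 0) (g (suc n)) ((shift f * g) n))
  where open +-*-Solver

-- Unfolding splits off the first term of `f * g`, and `*-suc` the last term of `g * f`; these two
-- match.
*-comm : ∀ f g n → (f * g) n ≡ (g * f) n
*-comm f g zero    = cong (ℤ._+ 0ℤ) (ℤ.*-comm (f 0) (g 0))
*-comm f g (suc n) = trans (cong₂ ℤ._+_ (ℤ.*-comm (f 0) (g (suc n))) (*-comm (shift f) g n)) (sym (*-suc g f n))

*-assoc : ∀ f g h n → ((f * g) * h) n ≡ (f * (g * h)) n
*-assoc f g h zero    = +-*-Solver.solve 3
  (λ f g h → (f :* g :+ con 0ℤ) :* h :+ con 0ℤ := f :* (g :* h :+ con 0ℤ) :+ con 0ℤ) refl (f 0) (g 0) (h 0)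
  where open +-*-Solver
*-assoc f g h (suc n) = begin
  (f * g) 0 ℤ.* h (suc n) ℤ.+ (shift (f * g) * h) n
    ≡⟨ cong (ℤ._+_ ((f * g) 0 ℤ.* h (suc n))) (begin
         (shift (f * g) * h) n
           -- By unfolding, `shift (f * g)` is `f 0` times `shift g` plus `shift f * g`.
           ≡⟨ *-distribʳ-+ h (λ k → f 0 ℤ.* g (suc k)) (shift f * g) n ⟩
         ((λ k → f 0 ℤ.* g (suc k)) * h) n ℤ.+ ((shift f * g) * h) n
           ≡⟨ cong₂ ℤ._+_ (*-scaleˡ (f 0) (shift g) h n) (*-assoc (shift f) g h n) ⟩
         f 0 ℤ.* (shift g * h) n ℤ.+ (shift f * (g * h)) n ∎) ⟩
  (f 0 ℤ.* g 0 ℤ.+ 0ℤ) ℤ.* h (suc n) ℤ.+ (f 0 ℤ.* (shift g * h) n ℤ.+ (shift f * (g * h)) n)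
    ≡⟨ solve 5 (λ a b c s t → (a :* b :+ con 0ℤ) :* c :+ (a :* s :+ t) := a :* (b :* c :+ s) :+ t)
         refl (f 0) (g 0) (h (suc n)) ((shift g * h) n) ((shift f * (g * h)) n) ⟩
  f 0 ℤ.* (g * h) (suc n) ℤ.+ (shift f * (g * h)) n ∎
  where
  open ≡-Reasoning
  open +-*-Solver

-- The quotient modulo qⁿ⁺¹ is taken by weakening equality, so every series is an element as it
-- stands. Products respect it since their coefficient at `k` involves only coefficients up to `k`.
truncated : ℕ → CommutativeRing 0ℓ 0ℓ
truncated n = record
  { Carrier = PowerSeries
  ; _≈_ = λ f g → ∀ {k} → k ℕ.≤ n → f k ≡ g k
  ; _+_ = _+_
  ; _*_ = _*_
  ; -_ = -_
  ; 0# = 0ₛ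
  ; 1# = 1ₛ
  ; isCommutativeRing = record
    { isRing = record
      { +-isAbelianGroup = record
        { isGroup = record
          { isMonoid = record
            { isSemigroup = record
              { isMagma = record
                { isEquivalence = record
                  { refl  = λ _ → refl
                  ; sym   = λ p k≤n → sym (p k≤n)
                  ; trans = λ p r k≤n → trans (p k≤n) (r k≤n)
                  }
                ; ∙-cong = λ p r k≤n → cong₂ ℤ._+_ (p k≤n) (r k≤n)
                }
              ; assoc = λ f g h {k} _ → ℤ.+-assoc (f k) (g k) (h k)
              }
            ; identity = (λ f {k} _ → ℤ.+-identityˡ (f k)) , (λ f {k} _ → ℤ.+-identityʳ (f k))
            }
          ; inverse = (λ f {k} _ → ℤ.+-inverseˡ (f k)) , (λ f {k} _ → ℤ.+-inverseʳ (f k))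
          ; ⁻¹-cong = λ p k≤n → cong ℤ.-_ (p k≤n)
          }
        ; comm = λ f g {k} _ → ℤ.+-comm (f k) (g k)
        }
      ; *-cong = λ {f} {f′} {g} {g′} p r {k} k≤n → *-cong-≤ {f} {f′} {g} {g′} k
          (λ j≤k → p (ℕ.≤-trans j≤k k≤n)) (λ j≤k → r (ℕ.≤-trans j≤k k≤n))
      ; *-assoc = λ f g h {k} _ → *-assoc f g h k
      ; *-identity = (λ f {k} _ → *-identityˡ f k) , (λ f {k} _ → *-identityʳ f k)
      ; distrib =
          (λ f g h {k} _ → trans (*-comm f (g + h) k)
            (trans (*-distribʳ-+ f g h k) (cong₂ ℤ._+_ (*-comm g f k) (*-comm h f k))))
        , (λ f g h {k} _ → *-distribʳ-+ f g h k)
      }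
    ; *-comm = λ f g {k} _ → *-comm f g k
    }
  }

-- `D m` is `1 / (q; q)ₘ`. In `E`, the series `F` covers the lists without an overlined `suc m` in
-- front, and the second summand prepends one. The sum stays unfactored to match the disjoint union
-- in `enum-Over` definitionally.
D E : ℕ → PowerSeries
D zero    = 1ₛ
D (suc m) = D m ÷ (1ₛ - q ^ suc m)
E zero    = 1ₛ
E (suc m) = F + q ^ suc m * F
  where F = E m + q ^ suc m * D (suc m)

D-suc : ∀ m n → D (suc m) n ≡ (D m + q ^ suc m * D (suc m)) n
D-suc m n = begin
  d n                             ≡⟨ //-rightDividesˡ ((u * d) n) (d n) ⟨
  d n ℤ.- (u * d) n ℤ.+ (u * d) n ≡⟨ cong (ℤ._+ (u * d) n) (begin
    d n ℤ.- (u * d) n             ≡⟨ cong (ℤ._- (u * d) n) (*-identityˡ d n) ⟨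
    (1ₛ * d) n ℤ.- (u * d) n      ≡⟨ [y-z]x≈yx-zx d 1ₛ u ℕ.≤-refl ⟨
    -- The divisor has constant term 1 by computation, its exponent `suc m` being positive.
    ((1ₛ - u) * d) n              ≡⟨ ÷-correct (1ₛ - u) (D m) refl n ⟩
    D m n                         ∎) ⟩
  D m n ℤ.+ (u * d) n             ∎
  where
  open ≡-Reasoning
  open import Algebra.Properties.AbelianGroup ℤ.+-0-abelianGroup using (//-rightDividesˡ)
  open import Algebra.Properties.Ring (CommutativeRing.ring (truncated n)) using ([y-z]x≈yx-zx)
  u d : PowerSeries
  u = q ^ suc m
  d = D (suc m)

-- With `M = suc n`, the power `q ^ M` vanishes in the truncated ring, and the products up to `M`
-- agree there with the infinite ones.
E-coefficient : ∀ n → E (suc n) n ≡ (qPoch∞ (- q) ^ 2 + 1ₛ ÷ qPoch∞ q - qPoch∞ (- q)) n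
E-coefficient n = E≈A²+D-A D E (λ _ → refl) D-suc′ (λ _ → refl) E-suc′ q^suc≈0
  {qPoch∞ (- q)} {qPoch∞ q} {1ₛ ÷ qPoch∞ q} (poch-limit (- q)) (poch-limit q) (λ {k} _ → 1÷qPoch∞-correct k) ℕ.≤-refl
  where
  open CommutativeRing (truncated n) using (_≈_)
  open Nilpotent (truncated n) q (suc n) renaming (_^_ to _^ₙ_)

  ^ₙ≡^ : ∀ m → q ^ₙ m ≡ q ^ m
  ^ₙ≡^ zero    = refl
  ^ₙ≡^ (suc m) = cong (q *_) (^ₙ≡^ m)

  poch≡qPoch : ∀ a m → poch a m ≡ qPoch a m
  poch≡qPoch a zero    = refl
  poch≡qPoch a (suc m) = cong₂ (λ f g → f * (1ₛ - a * g)) (poch≡qPoch a m) (^ₙ≡^ m)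

  poch-limit : ∀ a → poch a (suc n) ≈ qPoch∞ a
  poch-limit a {k} k≤n = trans (cong (λ f → f k) (poch≡qPoch a (suc n))) (qPoch-limit a (s≤s k≤n))

  D-suc′ : ∀ m → D (suc m) ≈ D m + q ^ₙ suc m * D (suc m)
  D-suc′ m {k} _ rewrite ^ₙ≡^ m = D-suc m k

  E-suc′ : ∀ m → E (suc m) ≈ E m + q ^ₙ suc m * D (suc m) + q ^ₙ suc m * (E m + q ^ₙ suc m * D (suc m))
  E-suc′ m _ rewrite ^ₙ≡^ m = refl

  q^suc≈0 : q ^ₙ suc n ≈ 0ₛ
  q^suc≈0 {k} k≤n = trans (cong (λ f → f k) (^ₙ≡^ (suc n))) (q^-vanishes (s≤s k≤n))

-- Enumeration of ℰᴼ by weight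

q^m*f-vanishes : ∀ {n} m f → n ℕ.< m → (q ^ m * f) n ≡ 0ℤ
q^m*f-vanishes {n} m f n<m = trans (*-cong-≤ {q ^ m} {0ₛ} {f} {f} n
  (λ k≤n → q^-vanishes (ℕ.≤-<-trans k≤n n<m)) (λ _ → refl)) (*-zeroˡ f n)

q^m*f-shift : ∀ m f n → (q ^ m * f) (m ℕ.+ n) ≡ f n
q^m*f-shift zero    f n = *-identityˡ f n
q^m*f-shift (suc m) f n = begin
  (q * q ^ m * f) (suc (m ℕ.+ n))           ≡⟨ *-assoc q (q ^ m) f (suc (m ℕ.+ n)) ⟩
  0ℤ ℤ.+ (1ₛ * (q ^ m * f)) (m ℕ.+ n)       ≡⟨ ℤ.+-identityˡ _ ⟩
  (1ₛ * (q ^ m * f)) (m ℕ.+ n)              ≡⟨ *-identityˡ (q ^ m * f) (m ℕ.+ n) ⟩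
  (q ^ m * f) (m ℕ.+ n)                     ≡⟨ q^m*f-shift m f n ⟩
  f n                                       ∎
  where open ≡-Reasoning

q^n-coefficient : ∀ n → (q ^ n) n ≡ 1ℤ
q^n-coefficient zero    = refl
q^n-coefficient (suc n) = trans (ℤ.+-identityˡ _) (trans (*-identityˡ (q ^ n) n) (q^n-coefficient n))

q^-support : ∀ m n → (q ^ m) n ≢ 0ℤ → m ≡ n
q^-support zero    zero    _  = refl
q^-support zero    (suc n) ≢0 = contradiction refl ≢0
q^-support (suc m) zero    ≢0 = contradiction refl ≢0
q^-support (suc m) (suc n) ≢0 = cong suc (q^-support m n λ q^m≡0 →
  ≢0 (trans (ℤ.+-identityˡ _) (trans (*-identityˡ (q ^ m) n) q^m≡0)))

-- `HasSum` at a single weight, counted by length. The count is an integer so that it can be a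
-- coefficient of a power series; disjoint union and prepending a part then mirror addition and
-- multiplication by a power of `q`.
record Enum (P : Pred (List Part) 0ℓ) (n : ℕ) (c : ℤ) : Set where
  field
    elements : List (List Part)
    unique   : Unique elements
    sound    : All (λ π → P π × weight π ≡ n) elements
    complete : ∀ {π} → P π → weight π ≡ n → π ∈ elements
    count    : ℤ.+ length elements ≡ c

open Enum

enum-resp : ∀ {P Q n c d} → P ⊆ Q → Q ⊆ P → c ≡ d → Enum P n c → Enum Q n d
enum-resp P⊆Q Q⊆P c≡d e = record
  { elements = elements e
  ; unique   = unique e
  ; sound    = All.map (λ (p , w) → P⊆Q p , w) (sound e)
  ; complete = λ p → complete e (Q⊆P p)
  ; count    = trans (count e) c≡d
  }

enum-empty : ∀ {P n} → (∀ {π} → P π → weight π ≢ n) → Enum P n 0ℤ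
enum-empty none = record
  { elements = []
  ; unique   = []
  ; sound    = []
  ; complete = λ p w → contradiction w (none p)
  ; count    = refl
  }

enum-[] : ∀ n → Enum (_≡ []) n (1ₛ n)
enum-[] zero    = record
  { elements = [] ∷ []
  ; unique   = [] ∷ []
  ; sound    = (refl , refl) ∷ []
  ; complete = λ p _ → here p
  ; count    = refl
  }
enum-[] (suc n) = enum-empty λ { refl () }

enum-∪ : ∀ {P Q n c d} → (∀ {π} → P π → ¬ Q π) → Enum P n c → Enum Q n d → Enum (P ∪ Q) n (c ℤ.+ d)
enum-∪ {P} {Q} {n} disjoint e e′ = record
  { elements = elements e ++ elements e′
  ; unique   = Unique.++⁺ (unique e) (unique e′)
      (λ (π∈e , π∈e′) → disjoint (proj₁ (All.lookup (sound e) π∈e)) (proj₁ (All.lookup (sound e′) π∈e′)))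
  ; sound    = All.++⁺ (All.map (λ (p , w) → inj₁ p , w) (sound e)) (All.map (λ (p , w) → inj₂ p , w) (sound e′))
  ; complete = covered
  ; count    = trans (cong ℤ.+_ (length-++ (elements e))) (cong₂ ℤ._+_ (count e) (count e′))
  }
  where
  covered : ∀ {π} → (P ∪ Q) π → weight π ≡ n → π ∈ elements e ++ elements e′
  covered (inj₁ p) w = ∈-++⁺ˡ (complete e p w)
  covered (inj₂ p) w = ∈-++⁺ʳ (elements e) (complete e′ p w)

data _◂_ (x : Part) (P : Pred (List Part) 0ℓ) : Pred (List Part) 0ℓ where
  cons : ∀ {π} → P π → (x ◂ P) (x ∷ π)

-- Tails are requested only at weights `k` with `size x + k ≡ n`, which lets a class be enumerated
-- from its own smaller weights.
enum-◂ : ∀ {P n} x f → (∀ k → size x ℕ.+ k ≡ n → Enum P k (f k)) → Enum (x ◂ P) n ((q ^ size x * f) n)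
enum-◂ {P} {n} x f e with size x ℕ.≤? n
... | no  x≰n = enum-resp (λ p → p) (λ p → p) (sym (q^m*f-vanishes (size x) f (ℕ.≰⇒> x≰n)))
                  (enum-empty λ { (cons _) refl → x≰n (ℕ.m≤m+n (size x) _) })
... | yes x≤n = record
  { elements = map (x ∷_) (elements e′)
  ; unique   = Unique.map⁺ ∷-injectiveʳ (unique e′)
  ; sound    = All.map⁺ (All.map (λ (p , w) → cons p , trans (cong (size x ℕ.+_) w) x+k≡n) (sound e′))
  ; complete = λ { (cons p) w → ∈-map⁺ (x ∷_) (complete e′ p (ℕ.+-cancelˡ-≡ (size x) _ _ (trans w (sym x+k≡n)))) }
  ; count    = trans (cong ℤ.+_ (length-map (x ∷_) (elements e′)))
                 (trans (count e′) (trans (sym (q^m*f-shift (size x) f k)) (cong (q ^ size x * f) x+k≡n)))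
  }
  where
  k : ℕ
  k = n ℕ.∸ size x
  x+k≡n : size x ℕ.+ k ≡ n
  x+k≡n = ℕ.m+[n∸m]≡n x≤n
  e′ : Enum P k (f k)
  e′ = e k x+k≡n

-- Classes of partitions with bounded parts

AtMost : ℕ → Pred (List Part) 0ℓ
AtMost m = All (λ x → size x ℕ.≤ m)

AllPlain : Pred (List Part) 0ℓ
AllPlain = All (λ x → overlined x ≡ false)

AtMost-≤ : ∀ {m n π} → m ℕ.≤ n → AtMost m π → AtMost n π
AtMost-≤ m≤n = All.map (λ x≤m → ℕ.≤-trans x≤m m≤n)

AtMost-weight : ∀ π → AtMost (weight π) π
AtMost-weight []      = []
AtMost-weight (x ∷ π) = ℕ.m≤m+n (size x) (weight π) ∷ AtMost-≤ (ℕ.m≤n+m (weight π) (size x)) (AtMost-weight π)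

-- Plain m and Over m are the partitions and the elements of ℰᴼ with all parts
-- ≤ m; Over′ m are the elements of Over (suc m) whose first part is not an
-- overlined suc m.
data Plain : ℕ → Pred (List Part) 0ℓ where
  []   : Plain 0 []
  skip : ∀ {m π} → Plain m π → Plain (suc m) π
  more : ∀ {m π} → Plain (suc m) π → Plain (suc m) (part (suc m) false ∷ π)

Over Over′ : ℕ → Pred (List Part) 0ℓ
Over zero    = _≡ []
Over (suc m) = Over′ m ∪ (part (suc m) true ◂ Over′ m)
Over′ m      = Over m ∪ (part (suc m) false ◂ Plain (suc m))

Plain⇒AtMost : ∀ {m π} → Plain m π → AtMost m π
Plain⇒AtMost []       = []
Plain⇒AtMost (skip p) = AtMost-≤ (ℕ.n≤1+n _) (Plain⇒AtMost p)
Plain⇒AtMost (more p) = ℕ.≤-refl ∷ Plain⇒AtMost p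

Over⇒AtMost : ∀ m {π} → Over m π → AtMost m π
Over′⇒AtMost : ∀ m {π} → Over′ m π → AtMost (suc m) π
Over⇒AtMost zero    refl            = []
Over⇒AtMost (suc m) (inj₁ p)        = Over′⇒AtMost m p
Over⇒AtMost (suc m) (inj₂ (cons p)) = ℕ.≤-refl ∷ Over′⇒AtMost m p
Over′⇒AtMost m (inj₁ p)        = AtMost-≤ (ℕ.n≤1+n m) (Over⇒AtMost m p)
Over′⇒AtMost m (inj₂ (cons p)) = ℕ.≤-refl ∷ Plain⇒AtMost p

AtMost⇒¬◂ : ∀ {m b P π} → AtMost m π → ¬ (part (suc m) b ◂ P) π
AtMost⇒¬◂ (m<m ∷ _) (cons _) = ℕ.1+n≰n m<m

-- `Plain (suc m)` recurs behind a part `suc m`, so the induction on `m` encloses a well-founded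
-- induction on the weight, which drops by `suc m`.
enum-Plain : ∀ m n → Enum (Plain m) n (D m n)
enum-Plain zero    n = enum-resp (λ { refl → [] }) (λ { [] → refl }) refl (enum-[] n)
enum-Plain (suc m) = <-rec _ λ n rec →
  enum-resp {Plain m ∪ (part (suc m) false ◂ Plain (suc m))} {Plain (suc m)}
            (λ { (inj₁ p) → skip p ; (inj₂ (cons p)) → more p })
            (λ { (skip p) → inj₁ p ; (more p) → inj₂ (cons p) })
            (sym (D-suc m n))
    (enum-∪ (λ p → AtMost⇒¬◂ (Plain⇒AtMost p)) (enum-Plain m n)
      (enum-◂ (part (suc m) false) (D (suc m)) λ { k refl → rec (s≤s (ℕ.m≤n+m k m)) }))

-- Induction on `m` suffices here: an overlined `suc m` is prepended at most once, and a plain one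
-- leaves a tail handled by `enum-Plain`.
enum-Over : ∀ m n → Enum (Over m) n (E m n)
enum-Over zero    n = enum-[] n
enum-Over (suc m) n = enum-∪ disjoint (enum-Over′ n)
  (enum-◂ (part (suc m) true) (E m + q ^ suc m * D (suc m)) (λ k _ → enum-Over′ k))
  where
  enum-Over′ : ∀ n → Enum (Over′ m) n ((E m + q ^ suc m * D (suc m)) n)
  enum-Over′ n = enum-∪ (λ p → AtMost⇒¬◂ (Over⇒AtMost m p)) (enum-Over m n)
    (enum-◂ (part (suc m) false) (D (suc m)) (λ k _ → enum-Plain (suc m) k))
  disjoint : ∀ {π} → Over′ m π → ¬ (part (suc m) true ◂ Over′ m) π
  disjoint (inj₁ p)        r  = AtMost⇒¬◂ (Over⇒AtMost m p) r
  disjoint (inj₂ (cons _)) ()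

-- Agreement of the recursive classes with `ℰᴼ`

[]-ℰᴼ : ℰᴼ []
[]-ℰᴼ = record
  { isOverpartition = record { positive = [] ; nonincreasing = [] ; firstOverlined = [] }
  ; overlined≥plain = λ ()
  }

-- The conditions that relate a first part to its tail. By `∷-ℰᴼ`, `head-ℰᴼ` and `tail-ℰᴼ`,
-- membership in `ℰᴼ` becomes a recursion along the list.
record Head (x : Part) (π : List Part) : Set where
  field
    positive : size x ℕ.> 0
    largest  : AtMost (size x) π
    first    : All (λ y → size x ≡ size y → overlined y ≡ false) π
    plain    : overlined x ≡ false → AllPlain π

∷-ℰᴼ : ∀ {x π} → Head x π → ℰᴼ π → ℰᴼ (x ∷ π)
∷-ℰᴼ {x} {π} h p = record
  { isOverpartition = record
    { positive       = Head.positive h ∷ IsOverpartition.positive op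
    ; nonincreasing  = linked (Head.largest h) (IsOverpartition.nonincreasing op)
    ; firstOverlined = Head.first h ∷ IsOverpartition.firstOverlined op
    }
  ; overlined≥plain = ordered
  }
  where
  op : IsOverpartition π
  op = ℰᴼ.isOverpartition p
  linked : ∀ {π} → AtMost (size x) π → Linked (λ x y → size x ℕ.≥ size y) π →
           Linked (λ x y → size x ℕ.≥ size y) (x ∷ π)
  linked []        _ = [-]
  linked (y≤x ∷ _) l = y≤x ∷ l
  ordered : ∀ {y z} → y ∈ x ∷ π → z ∈ x ∷ π → overlined y ≡ true → overlined z ≡ false → size y ℕ.≥ size z
  ordered (here refl) (here refl) _  _  = ℕ.≤-refl
  ordered (here refl) (there z∈π) _  _  = All.lookup (Head.largest h) z∈π
  ordered (there y∈π) (here refl) yo zp with () ← trans (sym yo) (All.lookup (Head.plain h zp) y∈π)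
  ordered (there y∈π) (there z∈π) yo zp = ℰᴼ.overlined≥plain p y∈π z∈π yo zp

tail-ℰᴼ : ∀ {x π} → ℰᴼ (x ∷ π) → ℰᴼ π
tail-ℰᴼ p = record
  { isOverpartition = record
    { positive       = All.tail (IsOverpartition.positive op)
    ; nonincreasing  = Linked.tail (IsOverpartition.nonincreasing op)
    ; firstOverlined = AllPairs.tail (IsOverpartition.firstOverlined op)
    }
  ; overlined≥plain = λ y∈π z∈π → ℰᴼ.overlined≥plain p (there y∈π) (there z∈π)
  }
  where op = ℰᴼ.isOverpartition p

head-ℰᴼ : ∀ {x π} → ℰᴼ (x ∷ π) → Head x π
head-ℰᴼ {x} {π} p = record
  { positive = All.head (IsOverpartition.positive op)
  ; largest  = largest
  ; first    = first
  ; plain    = λ xp → All.tabulate (plain xp)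
  }
  where
  op = ℰᴼ.isOverpartition p
  largest : AtMost (size x) π
  largest = AllPairs.head (Linked⇒AllPairs (flip ℕ.≤-trans) (IsOverpartition.nonincreasing op))
  first : All (λ y → size x ≡ size y → overlined y ≡ false) π
  first = AllPairs.head (IsOverpartition.firstOverlined op)
  plain : overlined x ≡ false → ∀ {y} → y ∈ π → overlined y ≡ false
  plain xp {part s false} y∈π = refl
  -- An overlined part behind a plain `x` is at least as large as `x` by the order condition and at
  -- most as large by monotonicity. The sizes being equal, it is a repeated occurrence and cannot be
  -- overlined.
  plain xp {part s true}  y∈π = All.lookup first y∈π
    (ℕ.≤-antisym (ℰᴼ.overlined≥plain p (there y∈π) (here refl) refl xp) (All.lookup largest y∈π))

Plain⇒AllPlain : ∀ {m π} → Plain m π → AllPlain π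
Plain⇒AllPlain []       = []
Plain⇒AllPlain (skip p) = Plain⇒AllPlain p
Plain⇒AllPlain (more p) = refl ∷ Plain⇒AllPlain p

head-Plain : ∀ {m π} → Plain (suc m) π → Head (part (suc m) false) π
head-Plain p = record
  { positive = s≤s z≤n
  ; largest  = Plain⇒AtMost p
  ; first    = All.map (λ yp _ → yp) (Plain⇒AllPlain p)
  ; plain    = λ _ → Plain⇒AllPlain p
  }

-- Any part of size `suc m` in such a list is plain, so an overlined one may still be put in front.
head-Over′ : ∀ m {π} → Over′ m π → Head (part (suc m) true) π
head-Over′ m {π} p = record
  { positive = s≤s z≤n
  ; largest  = Over′⇒AtMost m p
  ; first    = first p
  ; plain    = λ ()
  }
  where
  first : Over′ m π → All (λ y → suc m ≡ size y → overlined y ≡ false) π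
  first (inj₁ p)        = All.map (λ { y≤m refl → contradiction y≤m ℕ.1+n≰n }) (Over⇒AtMost m p)
  first (inj₂ (cons p)) = (λ _ → refl) ∷ Head.first (head-Plain p)

Plain⇒ℰᴼ : ∀ {m π} → Plain m π → ℰᴼ π
Plain⇒ℰᴼ []       = []-ℰᴼ
Plain⇒ℰᴼ (skip p) = Plain⇒ℰᴼ p
Plain⇒ℰᴼ (more p) = ∷-ℰᴼ (head-Plain p) (Plain⇒ℰᴼ p)

Over⇒ℰᴼ : ∀ m {π} → Over m π → ℰᴼ π
Over′⇒ℰᴼ : ∀ m {π} → Over′ m π → ℰᴼ π
Over⇒ℰᴼ zero    refl            = []-ℰᴼ
Over⇒ℰᴼ (suc m) (inj₁ p)        = Over′⇒ℰᴼ m p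
Over⇒ℰᴼ (suc m) (inj₂ (cons p)) = ∷-ℰᴼ (head-Over′ m p) (Over′⇒ℰᴼ m p)
Over′⇒ℰᴼ m (inj₁ p)        = Over⇒ℰᴼ m p
Over′⇒ℰᴼ m (inj₂ (cons p)) = ∷-ℰᴼ (head-Plain p) (Plain⇒ℰᴼ p)

head≤⇒AtMost : ∀ {m x π} → ℰᴼ (x ∷ π) → size x ℕ.≤ m → AtMost m (x ∷ π)
head≤⇒AtMost p x≤m = x≤m ∷ AtMost-≤ x≤m (Head.largest (head-ℰᴼ p))

-- The recursion is lexicographic: the bound drops if the first part is at most `m` or missing, and
-- the list shortens if that part is `suc m`.
ℰᴼ⇒Plain : ∀ m {π} → ℰᴼ π → AtMost m π → AllPlain π → Plain m π
ℰᴼ⇒Plain zero    {[]}    p _         _         = []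
ℰᴼ⇒Plain zero    {x ∷ π} p (x≤0 ∷ _) _         = contradiction x≤0 (ℕ.<⇒≱ (Head.positive (head-ℰᴼ p)))
ℰᴼ⇒Plain (suc m) {[]}    p _         _         = skip (ℰᴼ⇒Plain m p [] [])
ℰᴼ⇒Plain (suc m) {part s false ∷ π} p (s≤1+m ∷ π≤1+m) (refl ∷ πp) =
  [ (λ { (s≤s s≤m) → skip (ℰᴼ⇒Plain m p (head≤⇒AtMost p s≤m) (refl ∷ πp)) })
  , (λ s≡1+m → more-≡ s≡1+m (ℰᴼ⇒Plain (suc m) (tail-ℰᴼ p) π≤1+m πp))
  ]′ (ℕ.m≤n⇒m<n∨m≡n s≤1+m)
  where
  more-≡ : s ≡ suc m → Plain (suc m) π → Plain (suc m) (part s false ∷ π)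
  more-≡ refl = more

ℰᴼ⇒Over : ∀ m {π} → ℰᴼ π → AtMost m π → Over m π
-- The side condition reflects that `Over′ m` admits no overlined `suc m`; `ℰᴼ⇒Over` first strips
-- one from the front, if present.
ℰᴼ⇒Over′ : ∀ m {π} → ℰᴼ π → AtMost (suc m) π → (∀ {π′} → π ≢ part (suc m) true ∷ π′) → Over′ m π
ℰᴼ⇒Over zero    {[]}    p _         = refl
ℰᴼ⇒Over zero    {x ∷ π} p (x≤0 ∷ _) = contradiction x≤0 (ℕ.<⇒≱ (Head.positive (head-ℰᴼ p)))
ℰᴼ⇒Over (suc m) {[]}    p _         = inj₁ (ℰᴼ⇒Over′ m p [] λ ())
ℰᴼ⇒Over (suc m) {part s false ∷ π} p π≤1+m = inj₁ (ℰᴼ⇒Over′ m p π≤1+m λ ())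
ℰᴼ⇒Over (suc m) {part s true ∷ π}  p (s≤1+m ∷ π≤1+m) with s ℕ.≟ suc m
... | no  s≢1+m = inj₁ (ℰᴼ⇒Over′ m p (s≤1+m ∷ π≤1+m) λ { refl → s≢1+m refl })
-- The tail cannot start with a second overlined `suc m`, because only the first occurrence of a
-- size may be overlined.
... | yes refl  = inj₂ (cons (ℰᴼ⇒Over′ m (tail-ℰᴼ p) π≤1+m
                    λ { refl → contradiction (All.head (Head.first (head-ℰᴼ p)) refl) λ () }))
ℰᴼ⇒Over′ m {[]}           p _                _  = inj₁ (ℰᴼ⇒Over m p [])
ℰᴼ⇒Over′ m {part s b ∷ π} p (s≤1+m ∷ π≤1+m) ≢1+m with ℕ.m≤n⇒m<n∨m≡n s≤1+m | b
... | inj₁ (s≤s s≤m) | _     = inj₁ (ℰᴼ⇒Over m p (head≤⇒AtMost p s≤m))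
... | inj₂ refl      | true  = contradiction refl ≢1+m
... | inj₂ refl      | false = inj₂ (cons (ℰᴼ⇒Plain (suc m) (tail-ℰᴼ p) π≤1+m (Head.plain (head-ℰᴼ p) refl)))

mainTheorem6 : HasSum ℰᴼ (λ π → q ^ weight π)
    (qPoch∞ (- q) ^ 2 + 1ₛ ÷ qPoch∞ q - qPoch∞ (- q))
mainTheorem6 = record
  { support  = λ n → elements (enum n)
  ; unique   = λ n → unique (enum n)
  ; sound    = λ n → All.map (λ (p , _) → Over⇒ℰᴼ (suc n) p) (sound (enum n))
  ; complete = λ n π p ≢0 → covered n p (q^-support (weight π) n ≢0)
  ; total    = λ n → trans (total n (All.map proj₂ (sound (enum n)))) (trans (count (enum n)) (E-coefficient n))
  }
  where
  -- Weight `n` already bounds every part by `n`; the bound `suc n` is the index at which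
  -- `E-coefficient` evaluates the coefficient.
  enum : ∀ n → Enum (Over (suc n)) n (E (suc n) n)
  enum n = enum-Over (suc n) n
  covered : ∀ n {π} → ℰᴼ π → weight π ≡ n → π ∈ elements (enum n)
  covered n {π} p refl = complete (enum n) (ℰᴼ⇒Over (suc n) p (AtMost-≤ (ℕ.n≤1+n n) (AtMost-weight π))) refl
  total : ∀ n {πs} → All (λ π → weight π ≡ n) πs →
          foldr ℤ._+_ 0ℤ (map (λ π → (q ^ weight π) n) πs) ≡ ℤ.+ length πs
  total n []         = refl
  total n (refl ∷ w) = cong₂ ℤ._+_ (q^n-coefficient n) (total n w)
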